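{- Assume that every query is a $1$-additive approximation query. Then any algorithm requires in the worst case at least $n-1$ queries to detect the target $t$, even in graphs with unbounded diameter. That is, for every $D$ there is a connected graph $G$ of diameter at least $D$ such that, where $n$ is the number of vertices of $G$, for every (possibly adaptive) algorithm that always detects the unknown target in $G$, there exist a position of the target and valid (adversarial) $1$-additive approximation query responses that force the algorithm to make at least $n-1$ queries.
   Context: Graphs $G=(V,E)$ with $|V|=n$ are connected, simple, undirected, with a positive edge-weight function $w:E\to\mathbb{R}^+$ (the graph is unweighted if all weights are $1$). $d(v,u)$ is the length of a shortest path between $v$ and $u$ with respect to $w$, and $N(v)$ is the set of neighbors of $v$. There is one unknown target vertex $t\in V$; the graph is known to the algorithm. To detect $t$ means to determine with certainty which vertex is $t$. For $c\ge 0$, a $c$-additive approximation query at a vertex $v\neq t$ returns a (possibly adversarially chosen) neighbor $u\in N(v)$ such that $w(vu)+d(u,t)\le d(v,t)+c$; if $v=t$, the query reveals this. -}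

module Defs where

open import Data.Fin using (Fin)
open import Data.List using (List; []; _∷_)
open import Data.Nat using (ℕ; zero; suc)
open import Data.Product using (_×_; _,_; ∃-syntax)
open import Data.Rational using (ℚ; 0ℚ; _+_; _≤_; _<_)
open import Level using (0ℓ)
open import Relation.Binary.Core using (Rel)
open import Relation.Binary.Construct.Closure.ReflexiveTransitive
  using (Star; ε; _◅_)
open import Relation.Binary.Definitions using (Decidable; Irreflexive; Symmetric)
open import Relation.Binary.PropositionalEquality using (_≡_; _≢_)

-- Weights are rational, as the library has no real numbers.  A graph with
-- positive rational weights is in particular one with positive real weights.
-- The values of `weight` off the edges are irrelevant.
record Graph : Set₁ where
  field
    order           : ℕ
    _~_             : Rel (Fin order) 0ℓ
    _~?_            : Decidable _~_
    ~-irrefl        : Irreflexive _≡_ _~_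
    ~-sym           : Symmetric _~_
    weight          : Fin order → Fin order → ℚ
    weight-sym      : ∀ {u v} → u ~ v → weight u v ≡ weight v u
    weight-positive : ∀ {u v} → u ~ v → 0ℚ < weight u v
    connected       : ∀ u v → Star _~_ u v

  Vertex : Set
  Vertex = Fin order

  -- Vertices may repeat along a path.  Weights being positive, this does not
  -- affect the length of a shortest one.
  Path : Vertex → Vertex → Set
  Path = Star _~_

  length : ∀ {u v} → Path u v → ℚ
  length ε                         = 0ℚ
  length (_◅_ {i = u} {j = v} _ p) = weight u v + length p

  IsShortest : ∀ {u v} → Path u v → Set
  IsShortest {u} {v} p = (q : Path u v) → length p ≤ length q

  IsDistance : Vertex → Vertex → ℚ → Set
  IsDistance u v x = ∃[ p ] IsShortest {u} {v} p × length p ≡ x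

  IsDiameter : ℚ → Set
  IsDiameter δ =
    (∃[ u ] ∃[ v ] IsDistance u v δ) ×
    (∀ u v {x} → IsDistance u v x → x ≤ δ)

module Search (G : Graph) where
  open Graph G

  data Response : Set where
    found    : Response
    neighbor : Vertex → Response

  data ValidResponse (c : ℚ) (t v : Vertex) : Response → Set where
    found    : v ≡ t → ValidResponse c t v found
    neighbor : ∀ {u a b} → v ≢ t → v ~ u →
               IsDistance u t a → IsDistance v t b →
               weight v u + a ≤ b + c →
               ValidResponse c t v (neighbor u)

  -- Queries made so far with their responses, the most recent one first.
  History : Set
  History = List (Vertex × Response)

  data Action : Set where
    query  : Vertex → Action
    detect : Vertex → Action

  Algorithm : Set
  Algorithm = History → Action

  -- The adversary sees the history, so repeated queries at the same vertex may
  -- receive different responses.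
  Responder : Set
  Responder = History → Vertex → Response

  ValidResponder : ℚ → Vertex → Responder → Set
  ValidResponder c t ρ = ∀ h v → ValidResponse c t v (ρ h v)

  -- Run A ρ h x q: from history h on, A makes exactly q further queries,
  -- answered by ρ, and then stops, declaring x to be the target.
  data Run (A : Algorithm) (ρ : Responder) : History → Vertex → ℕ → Set where
    stop : ∀ {h x} → A h ≡ detect x → Run A ρ h x zero
    ask  : ∀ {h x v q} → A h ≡ query v →
           Run A ρ ((v , ρ h v) ∷ h) x q → Run A ρ h x (suc q)

  AlwaysDetects : ℚ → Algorithm → Set
  AlwaysDetects c A = ∀ t ρ → ValidResponder c t ρ → ∃[ q ] Run A ρ [] t q

{-# OPTIONS --safe #-}
module Submission where

-- Suppose every vertex v has a neighbor f v such that "f v" is a valid answer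
-- to a query at v whatever the target t ≠ v.  Answering f v at each vertex other
-- than the target then reveals nothing except that the queried vertex is not the
-- target: after fewer than order ∸ 1 queries two vertices remain unqueried, both
-- are consistent with all the answers, and an algorithm that is always correct
-- cannot stop.  Hence it makes order ∸ 1 queries along this run of answers, and
-- a vertex still unqueried then serves as the target (`lower-bound`).
--
-- Such graphs exist with arbitrarily large diameter, even with unit weights.
-- Replace each vertex of the path on K + 1 vertices by a pair of adjacent twins,
-- and join all vertices of consecutive pairs.  Let f exchange twins.  If v ≠ t
-- then d(f v, t) ≤ d(v, t), as both vertices lie in the same layer, so that
-- 1 + d(f v, t) ≤ d(v, t) + 1 (`twin-valid`).  Here d(v, t) is the difference of
-- the layers, raised to 1 for distinct vertices of the same layer.  It exceeds the
-- value at a neighbor of v by at most 1, whence no path is shorter, and it is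
-- attained by moving one layer at a time (`geodesic`).  For K ≥ 1 the diameter is K.

open import Data.Fin using (Fin; zero; suc; toℕ; fromℕ; inject₁; opposite; combine; quotient; remainder; _≟_)
open import Data.Fin.Properties using (toℕ-inject₁; toℕ-fromℕ; toℕ≤pred[n]; remQuot-combine; injective⇒≤; ¬∀⟶∃¬)
open import Data.Integer as ℤ using (+_; -[1+_])
import Data.Integer.Properties as ℤ
open import Data.List as List using (List; []; _∷_)
open import Data.List.Membership.DecPropositional using () renaming (_∈?_ to member?)
open import Data.List.Membership.Propositional using (_∈_; _∉_)
open import Data.List.Membership.Setoid.Properties using (index-injective)
open import Data.List.Properties using (length-map)
open import Data.List.Relation.Unary.Any using (here; there)
open import Data.Nat as ℕ using (ℕ; zero; suc; _∸_; _≤_; _<_; z≤n; s≤s; _⊔_; ∣_-_∣)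
import Data.Nat.Properties as ℕ
open import Data.Product using (_×_; _,_; proj₁; proj₂; Σ-syntax; ∃-syntax)
open import Data.Rational as ℚ using (ℚ; 0ℚ; 1ℚ; mkℚ; toℚᵘ; ↥_) renaming (_≤_ to _≤ℚ_)
import Data.Rational.Properties as ℚ
open import Data.Rational.Unnormalised as ℚᵘ using (mkℚᵘ; *≤*; *≡*; _≃_)
import Data.Rational.Unnormalised.Properties as ℚᵘ
open import Level using (0ℓ)
open import Relation.Binary.Construct.Closure.ReflexiveTransitive using (Star; ε; _◅_; fold)
open import Relation.Binary.Core using (Rel)
open import Relation.Binary.PropositionalEquality
open import Relation.Nullary using (yes; no; ¬?; contradiction; _×-dec_)
open import Defs

-- Natural numbers as rationals

-- The sum of n ones.  The recursion follows that of `Graph.length` on a path with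
-- unit weights.
_·1 : ℕ → ℚ
zero  ·1 = 0ℚ
suc n ·1 = 1ℚ ℚ.+ n ·1

0≤·1 : ∀ n → 0ℚ ≤ℚ n ·1
0≤·1 zero    = ℚ.≤-refl
0≤·1 (suc n) = ℚ.+-mono-≤ (ℚ.nonNegative⁻¹ 1ℚ) (0≤·1 n)

·1-mono-≤ : ∀ {m n} → m ≤ n → m ·1 ≤ℚ n ·1
·1-mono-≤ {n = n} z≤n = 0≤·1 n
·1-mono-≤ (s≤s m≤n)   = ℚ.+-monoʳ-≤ 1ℚ (·1-mono-≤ m≤n)

toℚᵘ-·1 : ∀ n → toℚᵘ (n ·1) ≃ mkℚᵘ (+ n) 0
toℚᵘ-·1 zero    = ℚᵘ.≃-refl
toℚᵘ-·1 (suc n) = ℚᵘ.≃-trans (ℚ.toℚᵘ-homo-+ 1ℚ (n ·1))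
  (ℚᵘ.≃-trans (ℚᵘ.+-congʳ (toℚᵘ 1ℚ) (toℚᵘ-·1 n))
              (*≡* (cong (λ i → (+ 1 ℤ.+ i) ℤ.* + 1) (ℤ.*-identityʳ (+ n)))))

-- A fraction is at most the absolute value of its numerator.
≤∣numerator∣·1 : ∀ p → p ≤ℚ ℤ.∣ ↥ p ∣ ·1
≤∣numerator∣·1 p = ℚ.toℚᵘ-cancel-≤
  (ℚᵘ.≤-trans (bound p) (ℚᵘ.≤-reflexive (ℚᵘ.≃-sym (toℚᵘ-·1 ℤ.∣ ↥ p ∣))))
  where
  bound : ∀ p → toℚᵘ p ℚᵘ.≤ mkℚᵘ (+ ℤ.∣ ↥ p ∣) 0
  bound (mkℚ (+ n)    d _) = *≤* (ℤ.*-monoˡ-≤-nonNeg (+ n) (ℤ.+≤+ (s≤s z≤n)))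
  bound (mkℚ -[1+ n ] d _) = *≤* ℤ.-≤+

-- The lower bound for graphs with uninformative answers

fresh : ∀ {n} (xs : List (Fin n)) → List.length xs < n → ∃[ v ] v ∉ xs
fresh {n} xs short = ¬∀⟶∃¬ n (_∈ xs) (λ v → member? _≟_ v xs)
  λ all → ℕ.<⇒≱ short (injective⇒≤ (λ {i} {j} → index-injective (setoid (Fin n)) (all i) (all j)))

n∸1<n : ∀ {n} → 0 < n → n ∸ 1 < n
n∸1<n (s≤s _) = ℕ.≤-refl

-- The vertex f v is a valid answer to a query at v for every target other than v.
module Uninformative (G : Graph) (c : ℚ)
  (f : Graph.Vertex G → Graph.Vertex G)
  (f-valid : ∀ {v t} → v ≢ t → Search.ValidResponse G c t v (Search.neighbor (f v)))
  where

  open Graph G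
  open Search G

  -- The adversary for the target t, which answers f v at every v ≠ t.
  responder : Vertex → Responder
  responder t h v with v ≟ t
  ... | yes _ = found
  ... | no  _ = neighbor (f v)

  responder-valid : ∀ t → ValidResponder c t (responder t)
  responder-valid t h v with v ≟ t
  ... | yes v≡t = found v≡t
  ... | no  v≢t = f-valid v≢t

  responder-≢ : ∀ {t v} h → v ≢ t → responder t h v ≡ neighbor (f v)
  responder-≢ {t} {v} h v≢t with v ≟ t
  ... | yes v≡t = contradiction v≡t v≢t
  ... | no  _   = refl

  queried : History → List Vertex
  queried = List.map proj₁

  unqueried : ∀ h → List.length h < order → ∃[ v ] v ∉ queried h
  unqueried h short = fresh (queried h)
    (subst (_< order) (sym (length-map proj₁ h)) short)

  module _ (A : Algorithm) (detects : AlwaysDetects c A) where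

    -- The run of A towards the target t passes through the history h after
    -- List.length h queries.
    PassesThrough : History → Vertex → Set
    PassesThrough h t = ∃[ q ] Run A (responder t) h t q ×
                               Run A (responder t) [] t (List.length h ℕ.+ q)

    -- After m queries answered by f, every unqueried target is still possible, and
    -- the history is the same for all of them.  Since at least two vertices are
    -- unqueried before each of these queries, A cannot stop earlier.
    common-history : ∀ m → m < order →
      Σ[ h ∈ History ] List.length h ≡ m × (∀ t → t ∉ queried h → PassesThrough h t)
    common-history zero    _   = [] , refl , λ t _ →
      let q , run = detects t (responder t) (responder-valid t) in q , run , run
    common-history (suc m) m+1<n
      with common-history m (ℕ.<-trans (ℕ.n<1+n m) m+1<n)
    ... | h , refl , passes
      with unqueried h (ℕ.<-trans (ℕ.n<1+n m) m+1<n)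
    ... | x , x∉h
      with passes x x∉h
    -- Stopping here would name x, although another vertex y remains possible.  The
    -- entry for x serves to find y ≠ x; its response is irrelevant.
    ... | _ , stop A-detects-x , _ =
      let y , y∉x∷h = unqueried ((x , found) ∷ h) m+1<n
      in contradiction (passes y (λ y∈h → y∉x∷h (there y∈h))) λ where
        (_ , stop A-detects-y , _) → y∉x∷h (here (detect-injective (trans (sym A-detects-y) A-detects-x)))
        (_ , ask A-queries _  , _) → detect≢query (trans (sym A-detects-x) A-queries)
      where
      detect-injective : ∀ {u v} → detect u ≡ detect v → u ≡ v
      detect-injective refl = refl
      detect≢query : ∀ {u v} → detect u ≢ query v
      detect≢query ()
    ... | _ , ask {v = v} A-queries-v _ , _ =
      (v , neighbor (f v)) ∷ h , refl , λ t t∉v∷h →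
        extend t (λ v≡t → t∉v∷h (here (sym v≡t))) (passes t (λ t∈h → t∉v∷h (there t∈h)))
      where
      extend : ∀ t → v ≢ t → PassesThrough h t → PassesThrough ((v , neighbor (f v)) ∷ h) t
      extend t v≢t (_ , stop A-detects , _) =
        contradiction (trans (sym A-detects) A-queries-v) λ ()
      extend t v≢t (suc q , ask A-queries rest , whole)
        with refl ← trans (sym A-queries) A-queries-v =
        q ,
        subst (λ r → Run A (responder t) ((v , r) ∷ h) t q) (responder-≢ h v≢t) rest ,
        subst (Run A (responder t) [] t) (ℕ.+-suc (List.length h) q) whole

    lower-bound : 0 < order → ∃[ t ] ∃[ ρ ] ∃[ q ]
      ValidResponder c t ρ × Run A ρ [] t q × order ∸ 1 ≤ q
    lower-bound 0<n
      with common-history (order ∸ 1) (n∸1<n 0<n)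
    ... | h , ∣h∣≡n∸1 , passes
      with unqueried h (subst (_< order) (sym ∣h∣≡n∸1) (n∸1<n 0<n))
    ... | t , t∉h
      with passes t t∉h
    ... | q , _ , run =
      t , responder t , List.length h ℕ.+ q , responder-valid t , run ,
      subst (_≤ List.length h ℕ.+ q) ∣h∣≡n∸1 (ℕ.m≤m+n _ q)

-- Distances in graphs with unit weights

hops : ∀ {V : Set} {R : Rel V 0ℓ} {u v} → Star R u v → ℕ
hops = fold (λ _ _ → ℕ) (λ _ → suc) 0

-- A function d that vanishes on the diagonal and drops by at most 1 along an edge
-- bounds the number of edges of every path from below.  If some path attains the
-- bound, then d is the distance.
module UnitWeights (G : Graph)
  (unit     : ∀ u v → Graph.weight G u v ≡ 1ℚ)
  (d        : Graph.Vertex G → Graph.Vertex G → ℕ)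
  (d-refl   : ∀ t → d t t ≡ 0)
  (d-step   : ∀ {v u} t → Graph._~_ G v u → d v t ≤ suc (d u t))
  (geodesic : ∀ v t → Σ[ p ∈ Graph.Path G v t ] hops p ≤ d v t)
  where

  open Graph G

  length≡hops : ∀ {u v} (p : Path u v) → length p ≡ hops p ·1
  length≡hops ε                         = refl
  length≡hops (_◅_ {i = u} {j = v} _ p) = cong₂ ℚ._+_ (unit u v) (length≡hops p)

  d≤hops : ∀ {v t} (p : Path v t) → d v t ≤ hops p
  d≤hops {v} ε           = ℕ.≤-reflexive (d-refl v)
  d≤hops {t = t} (e ◅ p) = ℕ.≤-trans (d-step t e) (s≤s (d≤hops p))

  isDistance : ∀ v t → IsDistance v t (d v t ·1)
  isDistance v t with geodesic v t
  ... | p , hops-p≤d = p , shortest , length-p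
    where
    length-p : length p ≡ d v t ·1
    length-p = trans (length≡hops p) (cong _·1 (ℕ.≤-antisym hops-p≤d (d≤hops p)))
    shortest : IsShortest p
    shortest q = subst₂ _≤ℚ_ (sym length-p) (sym (length≡hops q)) (·1-mono-≤ (d≤hops q))

  isDiameter : ∀ {k} u v → d u v ≡ k → (∀ x y → d x y ≤ k) → IsDiameter (k ·1)
  isDiameter {k} u v d≡k d≤k =
    (u , v , subst (λ m → IsDistance u v (m ·1)) d≡k (isDistance u v)) ,
    λ where
      x y (p , p-shortest , refl) →
        let q , _ , length-q = isDistance x y in
        ℚ.≤-trans (p-shortest q) (subst (_≤ℚ k ·1) (sym length-q) (·1-mono-≤ (d≤k x y)))

-- The path with doubled vertices

-- A number one step from a in the direction of b.
toward : ∀ {n} (a b : Fin n) → a ≢ b → Σ[ c ∈ Fin n ]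
  ∣ toℕ a - toℕ c ∣ ≡ 1 × suc ∣ toℕ c - toℕ b ∣ ≡ ∣ toℕ a - toℕ b ∣
toward zero    zero    a≢b = contradiction refl a≢b
toward {suc (suc n)} zero (suc b) _ = suc zero , refl , refl
toward (suc a) zero    _ = inject₁ a ,
  trans (cong (λ k → ∣ suc (toℕ a) - k ∣) (toℕ-inject₁ a)) (∣suc[n]-n∣≡1 (toℕ a)) ,
  cong suc (trans (ℕ.∣-∣-identityʳ _) (toℕ-inject₁ a))
  where
  ∣suc[n]-n∣≡1 : ∀ n → ∣ suc n - n ∣ ≡ 1
  ∣suc[n]-n∣≡1 zero    = refl
  ∣suc[n]-n∣≡1 (suc n) = ∣suc[n]-n∣≡1 n
toward (suc a) (suc b) a≢b =
  let c , a-c , c-b = toward a b (λ a≡b → a≢b (cong suc a≡b)) in suc c , a-c , c-b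

-- There are suc K layers of two vertices.  At least one step between layers is
-- required for the largest layer difference K to be the diameter.
module DoubledPath (K : ℕ) (1≤K : 1 ≤ K) where

  Vtx : Set
  Vtx = Fin (suc K ℕ.* 2)

  -- Vertices 2 a and 2 a + 1 form the layer a.
  layer : Vtx → Fin (suc K)
  layer = quotient 2

  -- The vertex with a given layer and a given position in it.
  vertex : Fin (suc K) → Fin 2 → Vtx
  vertex = combine

  layer-vertex : ∀ a i → layer (vertex a i) ≡ a
  layer-vertex a i = cong proj₁ (remQuot-combine a i)

  gap : Vtx → Vtx → ℕ
  gap v u = ∣ toℕ (layer v) - toℕ (layer u) ∣

  gap-refl : ∀ v → gap v v ≡ 0
  gap-refl v = ℕ.∣n-n∣≡0 (toℕ (layer v))

  same-layer : ∀ v u → layer v ≡ layer u → gap v u ≤ 1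
  same-layer v u eq = ℕ.≤-trans (ℕ.≤-reflexive (ℕ.m≡n⇒∣m-n∣≡0 (cong toℕ eq))) z≤n

  gap≤K : ∀ v u → gap v u ≤ K
  gap≤K v u = ℕ.≤-trans (ℕ.∣m-n∣≤m⊔n (toℕ (layer v)) (toℕ (layer u)))
    (ℕ.⊔-lub (toℕ≤pred[n] (layer v)) (toℕ≤pred[n] (layer u)))

  -- The distance between two vertices, by `UnitWeights.isDistance`.
  d : Vtx → Vtx → ℕ
  d v t with v ≟ t
  ... | yes _ = 0
  ... | no  _ = 1 ⊔ gap v t

  d-refl : ∀ t → d t t ≡ 0
  d-refl t with t ≟ t
  ... | yes _   = refl
  ... | no  t≢t = contradiction refl t≢t

  gap≤d : ∀ v t → gap v t ≤ d v t
  gap≤d v t with v ≟ t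
  ... | yes refl = ℕ.≤-reflexive (gap-refl v)
  ... | no  _    = ℕ.m≤n⊔m 1 (gap v t)

  d-positive : ∀ {v t} → v ≢ t → 1 ≤ d v t
  d-positive {v} {t} v≢t with v ≟ t
  ... | yes v≡t = contradiction v≡t v≢t
  ... | no  _   = ℕ.m≤m⊔n 1 (gap v t)

  d-least : ∀ v t {n} → 1 ≤ n → gap v t ≤ n → d v t ≤ n
  d-least v t 1≤n gap≤n with v ≟ t
  ... | yes _ = z≤n
  ... | no  _ = ℕ.⊔-lub 1≤n gap≤n

  -- Distinct vertices of the same or of consecutive layers are adjacent.
  _~_ : Rel Vtx 0ℓ
  v ~ u = v ≢ u × gap v u ≤ 1

  d-step : ∀ {v u} t → v ~ u → d v t ≤ suc (d u t)
  d-step {v} {u} t (_ , gap≤1) = d-least v t (s≤s z≤n)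
    (ℕ.≤-trans (ℕ.∣-∣-triangle (toℕ (layer v)) (toℕ (layer u)) (toℕ (layer t)))
               (ℕ.+-mono-≤ gap≤1 (gap≤d u t)))

  -- Induction on the bound n.  Vertices of layers more than 1 apart are connected
  -- through the layer next to that of v in the direction of t.
  geodesic-≤ : ∀ n v t → d v t ≤ n → Σ[ p ∈ Star _~_ v t ] hops p ≤ n
  geodesic-≤ n v t d≤n with v ≟ t
  geodesic-≤ n v t _   | yes refl = ε , z≤n
  geodesic-≤ zero    v t d≤0 | no _ = contradiction (ℕ.m⊔n≤o⇒m≤o 1 (gap v t) d≤0) λ ()
  geodesic-≤ (suc n) v t d≤n | no v≢t with gap v t ℕ.≤? 1
  ... | yes gap≤1 = (v≢t , gap≤1) ◅ ε , s≤s z≤n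
  ... | no  gap≰1
    with toward (layer v) (layer t) (λ eq → gap≰1 (same-layer v t eq))
  ... | a , v-a , a-t = (v≢u , ℕ.≤-reflexive v-u) ◅ p , s≤s hops-p≤n
    where
    -- Either vertex of the layer a will do.
    u : Vtx
    u = vertex a zero
    v-u : gap v u ≡ 1
    v-u = trans (cong (λ l → ∣ toℕ (layer v) - toℕ l ∣) (layer-vertex a zero)) v-a
    u-t : suc (gap u t) ≡ gap v t
    u-t = trans (cong (λ l → suc ∣ toℕ l - toℕ (layer t) ∣) (layer-vertex a zero)) a-t
    v≢u : v ≢ u
    v≢u v≡u = contradiction
      (trans (sym v-u) (trans (cong (gap v) (sym v≡u)) (gap-refl v))) λ ()
    gap-u≤n : gap u t ≤ n
    gap-u≤n = ℕ.s≤s⁻¹ (subst (_≤ suc n) (sym u-t) (ℕ.m⊔n≤o⇒n≤o 1 (gap v t) d≤n))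
    gap-u≥1 : 1 ≤ gap u t
    gap-u≥1 = ℕ.s≤s⁻¹ (subst (2 ≤_) (sym u-t) (ℕ.≰⇒> gap≰1))
    rest : Σ[ p ∈ Star _~_ u t ] hops p ≤ n
    rest = geodesic-≤ n u t (d-least u t (ℕ.≤-trans gap-u≥1 gap-u≤n) gap-u≤n)
    p = proj₁ rest
    hops-p≤n = proj₂ rest

  geodesic : ∀ v t → Σ[ p ∈ Star _~_ v t ] hops p ≤ d v t
  geodesic v t = geodesic-≤ (d v t) v t ℕ.≤-refl

  G : Graph
  G = record
    { order           = suc K ℕ.* 2
    ; _~_             = _~_
    ; _~?_            = λ v u → ¬? (v ≟ u) ×-dec (gap v u ℕ.≤? 1)
    ; ~-irrefl        = λ v≡u v~u → proj₁ v~u v≡u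
    ; ~-sym           = λ {v} {u} (v≢u , gap≤1) → ≢-sym v≢u ,
        subst (_≤ 1) (ℕ.∣-∣-comm (toℕ (layer v)) (toℕ (layer u))) gap≤1
    ; weight          = λ _ _ → 1ℚ
    ; weight-sym      = λ _ → refl
    ; weight-positive = λ _ → ℚ.positive⁻¹ 1ℚ
    ; connected       = λ v t → proj₁ (geodesic v t)
    }

  open Graph G using (IsDiameter)
  open Search G using (ValidResponse; neighbor)
  open UnitWeights G (λ _ _ → refl) d d-refl d-step geodesic

  diameter : IsDiameter (K ·1)
  diameter = isDiameter first last
    (ℕ.≤-antisym (d≤K first last) (subst (_≤ d first last) gap≡K (gap≤d first last))) d≤K
    where
    first last : Vtx
    first = vertex zero zero
    last  = vertex (fromℕ K) zero
    gap≡K : gap first last ≡ K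
    gap≡K = trans (cong toℕ (layer-vertex (fromℕ K) zero)) (toℕ-fromℕ K)
    d≤K : ∀ v t → d v t ≤ K
    d≤K v t = d-least v t 1≤K (gap≤K v t)

  -- The other vertex of the same layer.
  twin : Vtx → Vtx
  twin v = vertex (layer v) (opposite (remainder {suc K} 2 v))

  layer-twin : ∀ v → layer (twin v) ≡ layer v
  layer-twin v = layer-vertex (layer v) _

  twin-≢ : ∀ v → v ≢ twin v
  twin-≢ v v≡twin = opposite-≢ (remainder {suc K} 2 v)
    (trans (cong (remainder {suc K} 2) v≡twin)
           (cong proj₂ (remQuot-combine (layer v) (opposite (remainder {suc K} 2 v)))))
    where
    opposite-≢ : ∀ (i : Fin 2) → i ≢ opposite i
    opposite-≢ zero       ()
    opposite-≢ (suc zero) ()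

  twin-~ : ∀ v → v ~ twin v
  twin-~ v = twin-≢ v ,
    same-layer v (twin v) (sym (layer-twin v))

  d-twin : ∀ {v t} → v ≢ t → d (twin v) t ≤ d v t
  d-twin {v} {t} v≢t = d-least (twin v) t (d-positive v≢t)
    (subst (λ l → ∣ toℕ l - toℕ (layer t) ∣ ≤ d v t) (sym (layer-twin v)) (gap≤d v t))

  twin-valid : ∀ {v t} → v ≢ t → ValidResponse 1ℚ t v (neighbor (twin v))
  twin-valid {v} {t} v≢t =
    neighbor v≢t (twin-~ v) (isDistance (twin v) t) (isDistance v t)
      (subst (1ℚ ℚ.+ d (twin v) t ·1 ≤ℚ_) (ℚ.+-comm 1ℚ (d v t ·1))
             (·1-mono-≤ (s≤s (d-twin v≢t))))

theorem1 : (D : ℚ) →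
    Σ[ G ∈ Graph ] let open Graph G in let open Search G in
    (∃[ δ ] IsDiameter δ × D ≤ℚ δ) ×
    ((A : Algorithm) → AlwaysDetects 1ℚ A →
    ∃[ t ] ∃[ ρ ] ∃[ q ]
    ValidResponder 1ℚ t ρ × Run A ρ [] t q × order ∸ 1 ≤ q)
theorem1 D = G , (K ·1 , diameter , D≤K) , λ A detects →
  lower-bound A detects (s≤s z≤n)
  where
  -- The successor only ensures that K is positive.
  K : ℕ
  K = suc ℤ.∣ ↥ D ∣
  open DoubledPath K (s≤s z≤n)
  open Uninformative G 1ℚ twin twin-valid
  D≤K : D ≤ℚ K ·1
  D≤K = ℚ.≤-trans (≤∣numerator∣·1 D) (·1-mono-≤ (ℕ.n≤1+n ℤ.∣ ↥ D ∣))
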